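{- For every integer $s\ge 3$, every co-locally $(s-1)$-colourable graph $G \neq K_s$ of chromatic number $\chi < \frac{5s+2}{3}$ satisfies $\varphi(G) \ge \chi - s + 1$.
   Context: All graphs are finite, simple and non-empty. A graph $G$ is co-locally $t$-colourable if for every vertex $v$ and every vertex $u\neq v$, $\chi(G[\{u\}\cup N(v)])\le t$, where $N(v)$ is the open neighbourhood. For a proper colouring $\sigma$ of $G$, $\varphi_\sigma(G)=\max_{H}\big(|\sigma(V(H))|-\chi(H)\big)$ over all induced subgraphs $H$ of $G$, and $\varphi(G)=\min_\sigma\varphi_\sigma(G)$ over all proper colourings. -}

module Defs where

open import Data.Nat using (ℕ; _≤_; _<_; _+_; _*_)
open import Data.Nat.Properties using (_≟_)
open import Data.Fin using (Fin)
open import Data.Fin.Properties using () renaming (_≟_ to _≟ᶠ_)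
open import Data.Bool using (Bool; true; false; _∨_)
open import Data.List using (List; length; map; filterᵇ; deduplicate)
open import Data.List.Base using (allFin)
open import Data.Product using (Σ; ∃; ∃-syntax; _×_; _,_)
open import Relation.Nullary using (¬_; does)
open import Relation.Binary.PropositionalEquality using (_≡_; _≢_)

record Graph : Set where
  field
    n       : ℕ
    nonempty : 1 ≤ n
    adj     : Fin n → Fin n → Bool
    sym     : ∀ u v → adj u v ≡ adj v u
    irrefl  : ∀ v → adj v v ≡ false

open Graph public

-- A vertex subset (the vertex set of an induced subgraph).
VSet : Graph → Set
VSet G = Fin (n G) → Bool

NonEmpty : (G : Graph) → VSet G → Set
NonEmpty G S = ∃[ v ] S v ≡ true

Colourable : (G : Graph) → VSet G → ℕ → Set
Colourable G S k =
  Σ (Fin (n G) → Fin k) λ c →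
    ∀ u v → S u ≡ true → S v ≡ true → adj G u v ≡ true → c u ≢ c v

IsChromaticNumber : (G : Graph) → VSet G → ℕ → Set
IsChromaticNumber G S k = Colourable G S k × (∀ j → Colourable G S j → k ≤ j)

allV : (G : Graph) → VSet G
allV G _ = true

ChromaticNumber : Graph → ℕ → Set
ChromaticNumber G k = IsChromaticNumber G (allV G) k

ProperColouring : Graph → Set
ProperColouring G =
  Σ (Fin (n G) → ℕ) λ σ → ∀ u v → adj G u v ≡ true → σ u ≢ σ v

coloursUsed : (G : Graph) → (Fin (n G) → ℕ) → VSet G → ℕ
coloursUsed G σ S = length (deduplicate _≟_ (map σ (filterᵇ S (allFin (n G)))))

uPlusNbhd : (G : Graph) → Fin (n G) → Fin (n G) → VSet G
uPlusNbhd G u v w = does (w ≟ᶠ u) ∨ adj G v w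

CoLocallyColourable : Graph → ℕ → Set
CoLocallyColourable G t =
  ∀ (v u : Fin (n G)) → u ≢ v → Colourable G (uPlusNbhd G u v) t

IsComplete : Graph → ℕ → Set
IsComplete G s = (n G ≡ s) × (∀ u v → u ≢ v → adj G u v ≡ true)

-- φ_σ(G) + s ≥ χ + 1 rearranged in ℕ: for the colouring σ there is a
-- non-empty induced subgraph H with |σ(V(H))| - χ(H) ≥ m - s, written as
-- |σ(V(H))| + s ≥ χ(H) + m.
PhiSigmaAtLeast : (G : Graph) → ProperColouring G → ℕ → ℕ → Set
PhiSigmaAtLeast G (σ , _) m s =
  ∃[ S ] ∃[ h ] NonEmpty G S × IsChromaticNumber G S h
    × (h + m ≤ coloursUsed G σ S + s)

{-# OPTIONS --safe #-}
module Submission where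

{- Let χ ≥ s; otherwise one vertex suffices.  If σ uses m > χ colours, take for H a transversal Q of the colour classes.  If
   Q fails, then χ(Q) > s and 3 m < 5 χ(Q), so by Gallai a χ(Q)-critical subgraph of
   Q has a universal vertex v, contradicting that N[v] is s-colourable.  If σ uses
   exactly χ colours, every colour class contains a vertex v seeing all other
   colours; if the class has a second vertex u, then {u} ∪ N(v) shows all χ colours
   and is (s-1)-colourable.  If no class has a second vertex, G = K_χ, and
   (s-1)-colourability of {u} ∪ N(v) forces χ ≤ s, hence G = K_s.

   Gallai's 5/3 bound is proved directly.  Consider an optimal colouring τ of a
   critical graph with as few singleton classes as possible.  By an exchange
   argument every vertex reachable from a singleton through non-edges is a
   singleton in some such τ, and no two singletons of τ are joined by a path of
   non-edges.  So a non-universal singleton v has non-neighbours in at least two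
   other classes, and no other singleton has a non-neighbour there.  Hence
   singletons are outnumbered twice over by larger classes. -}

open import Defs renaming (n to order; sym to adj-symmetric)
open import Data.Nat using (ℕ; zero; suc; _≤_; _<_; _≰_; _+_; _*_; _∸_; z≤n; s≤s; _≤?_; _<?_)
open import Data.Nat.Properties hiding (_≟_; suc-injective)
open import Data.Nat.Properties using () renaming (_≟_ to _≟ℕ_)
open import Data.Nat.Induction using (<-rec)
open import Data.Nat.Tactic.RingSolver using (solve-∀)
open import Data.Bool using (true; false; _∨_; T?)
open import Data.Bool.Properties using (∨-zeroʳ; T-≡) renaming (_≟_ to _≟ᵇ_)
open import Data.Fin using (Fin; zero; suc; punchIn; punchOut; inject≤; fromℕ<)
open import Data.Fin.Properties using (_≟_; any?; all?; suc-injective; punchInᵢ≢i; punchIn-punchOut; punchOut-injective; inject≤-injective; injective⇒≤; ¬∀⟶∃¬)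
open import Data.List using (List; _∷_; length; lookup; map; filterᵇ; deduplicate; allFin)
open import Data.List.Membership.Propositional using (_∈_)
open import Data.List.Membership.Propositional.Properties using (∈-map⁺; ∈-map⁻; ∈-filter⁺; ∈-allFin; ∈-lookup; ∈-deduplicate⁺; ∈-deduplicate⁻)
open import Data.List.Membership.Setoid.Properties using (index-injective)
open import Data.List.Relation.Unary.All using () renaming (lookup to All-lookup)
open import Data.List.Relation.Unary.AllPairs using (_∷_)
open import Data.List.Relation.Unary.Any using (index)
open import Data.List.Relation.Unary.Any.Properties using (lookup-index)
open import Data.List.Relation.Unary.Unique.Propositional using (Unique)
open import Data.List.Relation.Unary.Unique.DecPropositional.Properties using (deduplicate-!)
open import Data.Product using (∃; _×_; _,_; proj₁; proj₂)
open import Data.Sum as Sum using (_⊎_; inj₁; inj₂)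
open import Data.Empty using (⊥; ⊥-elim)
open import Data.Vec.Functional using (updateAt) renaming (_∷_ to _∷ᶠ_)
open import Data.Vec.Functional.Properties using (updateAt-updates; updateAt-minimal)
open import Function using (_∘_; const; case_of_; Equivalence)
open import Relation.Nullary using (¬_; Dec; yes; no; does; contradiction)
open import Relation.Nullary.Decidable using (decidable-stable; dec-true; ¬¬-excluded-middle; _×-dec_; _⊎-dec_; _→-dec_; ¬?; map′)
open import Relation.Nullary.Negation using (DoubleNegation)
open import Relation.Unary using (Decidable)
open import Relation.Binary.PropositionalEquality using (_≡_; _≢_; _≗_; refl; sym; trans; cong; cong₂; subst; subst₂; setoid)
open import Relation.Binary.Construct.Closure.ReflexiveTransitive using (Star; ε; _◅_)
open import Algebra.Properties.Semiring.Sum +-*-semiring using (sum; ∑-comm; ∑-distrib-+; *-distribˡ-sum)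

private variable
  n : ℕ
  P Q : Fin n → Set

-- Sums and counts over finite index sets.

sum-mono-≤ : {f g : Fin n → ℕ} → (∀ i → f i ≤ g i) → sum f ≤ sum g
sum-mono-≤ {zero}  f≤g = z≤n
sum-mono-≤ {suc n} f≤g = +-mono-≤ (f≤g zero) (sum-mono-≤ (f≤g ∘ suc))

sum-mono-< : {f g : Fin n → ℕ} → (∀ i → f i ≤ g i) → ∀ i → f i < g i → sum f < sum g
sum-mono-< f≤g zero    fi<gi = +-mono-<-≤ fi<gi (sum-mono-≤ (f≤g ∘ suc))
sum-mono-< f≤g (suc i) fi<gi = +-mono-≤-< (f≤g zero) (sum-mono-< (f≤g ∘ suc) i fi<gi)

sum-const : ∀ n k → sum {n} (const k) ≡ n * k
sum-const zero    k = refl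
sum-const (suc n) k = cong (k +_) (sum-const n k)

indicator : {A : Set} → Dec A → ℕ
indicator (yes _) = 1
indicator (no _)  = 0

indicator-mono : {A B : Set} (a? : Dec A) (b? : Dec B) → (A → B) → indicator a? ≤ indicator b?
indicator-mono (yes a) (yes _) _ = ≤-refl
indicator-mono (yes a) (no ¬b) f = contradiction (f a) ¬b
indicator-mono (no _)  _       _ = z≤n

indicator-yes : {A : Set} (a? : Dec A) → A → indicator a? ≡ 1
indicator-yes (yes _) _ = refl
indicator-yes (no ¬a) a = contradiction a ¬a

indicator-no : {A : Set} (a? : Dec A) → ¬ A → indicator a? ≡ 0
indicator-no (yes a) ¬a = contradiction a ¬a
indicator-no (no _)  _  = refl

count : {P : Fin n → Set} → Decidable P → ℕ
count P? = sum (indicator ∘ P?)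

count-mono-< : (P? : Decidable P) (Q? : Decidable Q) → (∀ i → P i → Q i) →
               ∀ i → ¬ P i → Q i → count P? < count Q?
count-mono-< P? Q? f i ¬p q = sum-mono-< (λ j → indicator-mono (P? j) (Q? j) (f j)) i
  (subst₂ _<_ (sym (indicator-no (P? i) ¬p)) (sym (indicator-yes (Q? i) q)) (s≤s z≤n))

count≤n : {P : Fin n → Set} (P? : Decidable P) → count P? ≤ n
count≤n {n = n} P? = ≤-trans (sum-mono-≤ {g = const 1} (indicator≤1 ∘ P?))
                         (≤-reflexive (trans (sum-const n 1) (*-identityʳ n)))
  where
  indicator≤1 : {A : Set} (a? : Dec A) → indicator a? ≤ 1
  indicator≤1 (yes _) = ≤-refl
  indicator≤1 (no _)  = z≤n

count-none : (P? : Decidable P) → (∀ i → ¬ P i) → count P? ≡ 0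
count-none {zero}  P? ¬P = refl
count-none {suc n} P? ¬P = cong₂ _+_ (indicator-no (P? zero) (¬P zero)) (count-none (P? ∘ suc) (¬P ∘ suc))

count-unique : (P? : Decidable P) → (∀ i j → P i → P j → i ≡ j) → count P? ≤ 1
count-unique {zero}  P? uniq = z≤n
count-unique {suc n} P? uniq with P? zero
... | yes p = s≤s (≤-reflexive (count-none (P? ∘ suc) λ i q → case uniq zero (suc i) p q of λ ()))
... | no _  = count-unique (P? ∘ suc) λ i j p q → suc-injective (uniq (suc i) (suc j) p q)

count-∪-singleton : (P? : Decidable P) (Q? : Decidable Q) → ∀ z →
                    (∀ i → P i → Q i ⊎ i ≡ z) → count P? ≤ suc (count Q?)
count-∪-singleton {P = P} {Q = Q} P? Q? z f = begin
  count P?                                               ≤⟨ sum-mono-≤ pointwise ⟩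
  sum (λ i → indicator (i ≟ z) + indicator (Q? i))        ≡⟨ ∑-distrib-+ (λ i → indicator (i ≟ z)) (indicator ∘ Q?) ⟩
  count (_≟ z) + count Q?                                 ≤⟨ +-monoˡ-≤ _ (count-unique (_≟ z) λ i j i≡z j≡z → trans i≡z (sym j≡z)) ⟩
  suc (count Q?)                                          ∎
  where
  open ≤-Reasoning
  pointwise : ∀ i → indicator (P? i) ≤ indicator (i ≟ z) + indicator (Q? i)
  pointwise i with P? i
  ... | no _ = z≤n
  ... | yes p with f i p
  ...   | inj₁ q = ≤-trans (≤-reflexive (sym (indicator-yes (Q? i) q))) (m≤n+m _ _)
  ...   | inj₂ e = ≤-trans (≤-reflexive (sym (indicator-yes (i ≟ z) e))) (m≤m+n _ _)

module _ (P? : Decidable P) (Q? : Decidable Q) (z : Fin n) (P⊆Q∪z : ∀ i → P i → Q i ⊎ i ≡ z) where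

  private
    Q∪z? : Decidable (λ i → Q i ⊎ i ≡ z)
    Q∪z? i = Q? i ⊎-dec i ≟ z

  -- The only possible gain `z` is paid for by the loss of `x`; a second lost element makes the
  -- inequality strict.
  count-exchange : ∀ x → ¬ P x → Q x → count P? ≤ count Q?
  count-exchange x ¬px qx = ≤-pred (≤-trans
    (count-mono-< P? Q∪z? P⊆Q∪z x ¬px (inj₁ qx))
    (count-∪-singleton Q∪z? Q? z λ _ h → h))

  count-exchange-< : ∀ x y → x ≢ y → ¬ P x → Q x → ¬ P y → Q y → count P? < count Q?
  count-exchange-< x y x≢y ¬px qx ¬py qy = ≤-pred (≤-trans
    (s≤s (count-mono-< P? P∪x? (λ _ → inj₁) x ¬px (inj₂ refl)))
    (≤-trans
      (count-mono-< P∪x? Q∪z? (λ { i (inj₁ p) → P⊆Q∪z i p ; i (inj₂ refl) → inj₁ qx }) y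
        (λ { (inj₁ p) → ¬py p ; (inj₂ y≡x) → x≢y (sym y≡x) }) (inj₁ qy))
      (count-∪-singleton Q∪z? Q? z λ _ h → h)))
    where
    P∪x? : Decidable (λ i → P i ⊎ i ≡ x)
    P∪x? i = P? i ⊎-dec i ≟ x

count-one : (P? : Decidable P) → ∀ i → P i → 1 ≤ count P?
count-one P? i p = ≤-trans (s≤s z≤n) (count-mono-< {P = λ _ → ⊥} (λ _ → no λ ()) P? (λ _ ()) i (λ ()) p)

count-two : (P? : Decidable P) → ∀ i j → i ≢ j → P i → P j → 2 ≤ count P?
count-two P? i j i≢j p q = ≤-trans (s≤s (count-one (_≟ i) i refl))
  (count-mono-< (_≟ i) P? (λ { _ refl → p }) j (λ j≡i → i≢j (sym j≡i)) q)

-- Descent on the value of `f`. The conclusion is doubly negated because the existence of a smaller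
-- value is not assumed decidable; it is used only towards contradictions.
minimal : {A : Set} (P : A → Set) (f : A → ℕ) → ∃ P →
          DoubleNegation (∃ λ a → P a × (∀ b → P b → f a ≤ f b))
minimal P f (a , pa) none = go (f a) a refl pa
  where
  go : ∀ k a → f a ≡ k → ¬ P a
  go = <-rec _ λ k rec a fa≡k pa → none (a , pa , λ b pb →
    ≮⇒≥ λ fb<fa → rec (subst (f b <_) fa≡k fb<fa) b refl pb)

-- Singleton colour classes and recolouring.

module Colourings {m q : ℕ} (Adj : Fin m → Fin m → Set) (adj? : ∀ u v → Dec (Adj u v))
                  (adj-sym : ∀ {u v : Fin m} → Adj u v → Adj v u) where

  Colouring : Set
  Colouring = Fin m → Fin q

  Proper : Colouring → Set
  Proper c = ∀ {u v} → c u ≡ c v → ¬ Adj u v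

  Single : Colouring → Fin m → Set
  Single c v = ∀ w → c w ≡ c v → w ≡ v

  singleOrMate : ∀ c v → Single c v ⊎ ∃ λ w → w ≢ v × c w ≡ c v
  singleOrMate c v with any? (λ w → ¬? (w ≟ v) ×-dec c w ≟ c v)
  ... | yes mate = inj₂ mate
  ... | no ¬mate = inj₁ λ w cw≡cv → decidable-stable (w ≟ v) λ w≢v → ¬mate (w , w≢v , cw≡cv)

  single? : ∀ c v → Dec (Single c v)
  single? c v with singleOrMate c v
  ... | inj₁ s = yes s
  ... | inj₂ (w , w≢v , e) = no λ s → w≢v (s w e)

  singles : Colouring → ℕ
  singles c = count (single? c)

  module Onto (onto : ∀ c → Proper c → ∀ i → ∃ λ v → c v ≡ i) where

    recolour : Colouring → Fin m → Fin m → Colouring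
    recolour c x y = updateAt c y (const (c x))

    module _ {c : Colouring} {x y : Fin m} where

      recolour-at : recolour c x y y ≡ c x
      recolour-at = updateAt-updates y c

      recolour-off : ∀ {v} → v ≢ y → recolour c x y v ≡ c v
      recolour-off {v} v≢y = updateAt-minimal v y c v≢y

      recolour-proper : Proper c → (∀ w → c w ≡ c x → ¬ Adj w y) → Proper (recolour c x y)
      recolour-proper pc free {u} {v} e with u ≟ y | v ≟ y
      ... | yes refl | yes refl = pc refl
      ... | yes refl | no v≢y = λ a → free v (trans (sym (recolour-off v≢y)) (trans (sym e) recolour-at)) (adj-sym a)
      ... | no u≢y | yes refl = free u (trans (sym (recolour-off u≢y)) (trans e recolour-at))
      ... | no u≢y | no v≢y = pc (trans (sym (recolour-off u≢y)) (trans e (recolour-off v≢y)))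

    -- Otherwise recolouring x like y would leave the colour of x unused.
    single-meets-class : ∀ {c x y} → Proper c → Single c x → y ≢ x → ∃ λ z → c z ≡ c y × Adj x z
    single-meets-class {c} {x} {y} pc sx y≢x with any? (λ z → c z ≟ c y ×-dec adj? x z)
    ... | yes found = found
    ... | no none = ⊥-elim unused
      where
      unused : ⊥
      unused with onto (recolour c y x)
                    (recolour-proper {c} {y} {x} pc λ w e a → none (w , e , adj-sym a)) (c x)
      ... | w , e with w ≟ x
      ...   | yes refl = y≢x (sx y (trans (sym (recolour-at {c} {y} {x})) e))
      ...   | no w≢x = w≢x (sx w (trans (sym (recolour-off {c} {y} {x} w≢x)) e))

    singles-adjacent : ∀ {c u v} → Proper c → Single c u → Single c v → u ≢ v → Adj u v
    singles-adjacent pc su sv u≢v with single-meets-class pc su (u≢v ∘ sym)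
    ... | z , e , a = subst (Adj _) (sv z e) a

    -- When `y` joins the class of `x`, `x` stops being a singleton. The old class of `y` contains a
    -- neighbour `z` of `x`, and only `z` can become a singleton, namely when that class was a pair.
    -- So if the number of singletons does not drop, it was a pair.
    move : ∀ {c x y} → Proper c → Single c x → y ≢ x → ¬ Adj x y →
           Proper (recolour c x y) × singles (recolour c x y) ≤ singles c ×
           ∃ λ z → z ≢ y × c z ≡ c y × Adj x z ×
             (singles c ≤ singles (recolour c x y) → ∀ w → c w ≡ c y → w ≡ y ⊎ w ≡ z)
    move {c} {x} {y} pc sx y≢x ¬xy with single-meets-class pc sx y≢x
    ... | z , cz≡cy , xz =
      recolour-proper {c} {x} {y} pc (λ w e → subst (λ w → ¬ Adj w y) (sym (sx w e)) ¬xy) ,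
      count-exchange (single? c′) (single? c) z survivors x lost sx ,
      z , z≢y , cz≡cy , xz , exact
      where
      c′ : Colouring
      c′ = recolour c x y
      at : c′ y ≡ c x
      at = recolour-at {c} {x} {y}
      off : ∀ {v} → v ≢ y → c′ v ≡ c v
      off = recolour-off {c} {x} {y}
      z≢y : z ≢ y
      z≢y refl = ¬xy xz
      lost : ¬ Single c′ x
      lost s = y≢x (s y (trans at (sym (off (y≢x ∘ sym)))))
      survivors : ∀ w → Single c′ w → Single c w ⊎ w ≡ z
      survivors w s with w ≟ y
      ... | yes refl = contradiction (s x (trans (off (y≢x ∘ sym)) (sym at))) (y≢x ∘ sym)
      ... | no w≢y with c w ≟ c y
      ...   | yes e = inj₂ (sym (s z (trans (off z≢y) (trans cz≡cy (trans (sym e) (sym (off w≢y)))))))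
      ...   | no cw≢cy = inj₁ λ u e → s u (trans (off λ { refl → cw≢cy (sym e) }) (trans e (sym (off w≢y))))
      exact : singles c ≤ singles c′ → ∀ w → c w ≡ c y → w ≡ y ⊎ w ≡ z
      exact s≤s′ w e with w ≟ y
      ... | yes w≡y = inj₁ w≡y
      ... | no w≢y with w ≟ z
      ...   | yes w≡z = inj₂ w≡z
      ...   | no w≢z = contradiction (count-mono-< (single? c′) (single? c) strict x lost sx) (≤⇒≯ s≤s′)
        where
        strict : ∀ v → Single c′ v → Single c v
        strict v s with survivors v s
        ... | inj₁ sv = sv
        ... | inj₂ refl = contradiction
          (s w (trans (off w≢y) (trans e (trans (sym cz≡cy) (sym (off z≢y)))))) w≢z

    -- Aligning the singletons of one colouring with those of another.

    Mate : Colouring → Colouring → Fin m → Set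
    Mate τ c v = ∃ λ w → w ≢ v × c w ≡ c v × τ w ≡ τ v

    mate? : ∀ τ c v → Dec (Mate τ c v)
    mate? τ c v = any? λ w → ¬? (w ≟ v) ×-dec c w ≟ c v ×-dec τ w ≟ τ v

    -- The potential that grows as `c` is brought closer to `τ`.
    mates : Colouring → Colouring → ℕ
    mates τ c = count (mate? τ c)

    -- Minimality is relative to colourings that keep `t` single, since it is not known in advance
    -- that `t` is single in a globally optimal one.
    Protected : Fin m → Colouring → Set
    Protected t c = (Proper c × Single c t) × (∀ c′ → Proper c′ × Single c′ t → singles c ≤ singles c′)

    -- A singleton x ≠ t of c lying in a larger class of τ, say with y, absorbs y.
    -- The class of y in c must be a pair {y , z} with z adjacent to x, so z takes
    -- over as singleton and no vertex loses a mate common to c and τ.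
    align : ∀ τ → Proper τ → ∀ t c → Protected t c →
            ∃ λ c′ → Protected t c′ × (∀ x → Single c′ x → Single τ x ⊎ x ≡ t)
    -- The potential is at most m and grows in each round, so m rounds of fuel are enough.
    align τ pτ t c₀ = go m c₀ (m≤n+m m (mates τ c₀))
      where
      go : ∀ k c → m ≤ mates τ c + k → Protected t c →
           ∃ λ c′ → Protected t c′ × (∀ x → Single c′ x → Single τ x ⊎ x ≡ t)
      go k c fuel prot@((pc , st) , least)
        with any? (λ x → single? c x ×-dec ¬? (x ≟ t) ×-dec ¬? (single? τ x))
      ... | no none = c , prot , λ x s → decidable-stable (single? τ x ⊎-dec x ≟ t)
                        λ ¬h → none (x , s , ¬h ∘ inj₂ , ¬h ∘ inj₁)
      ... | yes (x , sx , x≢t , ¬τx) with singleOrMate τ x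
      ...   | inj₁ s = contradiction s ¬τx
      ...   | inj₂ (y , y≢x , τy≡τx) = next k fuel
        where
        ¬xy : ¬ Adj x y
        ¬xy = pτ (sym τy≡τx)
        y≢t : y ≢ t
        y≢t refl = ¬xy (singles-adjacent pc sx st x≢t)
        c′ : Colouring
        c′ = recolour c x y
        at : c′ y ≡ c x
        at = recolour-at {c} {x} {y}
        off : ∀ {v} → v ≢ y → c′ v ≡ c v
        off = recolour-off {c} {x} {y}
        moved = move pc sx y≢x ¬xy
        z = proj₁ (proj₂ (proj₂ moved))
        xz : Adj x z
        xz = proj₁ (proj₂ (proj₂ (proj₂ (proj₂ (proj₂ moved)))))
        st′ : Single c′ t
        st′ u e with u ≟ y
        ... | yes refl = contradiction (st x (trans (sym at) (trans e (off (y≢t ∘ sym))))) x≢t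
        ... | no u≢y = st u (trans (sym (off u≢y)) (trans e (off (y≢t ∘ sym))))
        exact : ∀ w → c w ≡ c y → w ≡ y ⊎ w ≡ z
        exact = proj₂ (proj₂ (proj₂ (proj₂ (proj₂ (proj₂ moved))))) (least c′ (proj₁ moved , st′))
        prot′ : Protected t c′
        prot′ = (proj₁ moved , st′) , λ d h → ≤-trans (proj₁ (proj₂ moved)) (least d h)
        -- The pair of `y` and `z`, which is split, was not a pair of mates: `z` is adjacent to `x`,
        -- which shares a class of `τ` with `y`.
        τz≢τy : τ z ≢ τ y
        τz≢τy e = pτ (sym (trans e τy≡τx)) xz
        keep : ∀ w → Mate τ c w → Mate τ c′ w
        keep w (u , u≢w , cu≡cw , τu≡τw) with w ≟ y | u ≟ y
        ... | yes refl | _ with exact u cu≡cw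
        ...   | inj₁ u≡y = contradiction u≡y u≢w
        ...   | inj₂ refl = contradiction τu≡τw τz≢τy
        keep w (u , u≢w , cu≡cw , τu≡τw) | no w≢y | yes refl with exact w (sym cu≡cw)
        ...   | inj₁ w≡y = contradiction w≡y w≢y
        ...   | inj₂ refl = contradiction (sym τu≡τw) τz≢τy
        keep w (u , u≢w , cu≡cw , τu≡τw) | no w≢y | no u≢y =
          u , u≢w , trans (off u≢y) (trans cu≡cw (sym (off w≢y))) , τu≡τw
        gain : mates τ c < mates τ c′
        gain = count-mono-< (mate? τ c) (mate? τ c′) keep x
          (λ (w , w≢x , e , _) → w≢x (sx w e))
          (y , y≢x , trans at (sym (off (y≢x ∘ sym))) , τy≡τx)
        next : ∀ k → m ≤ mates τ c + k → _
        next zero    fuel = contradiction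
          (≤-trans gain (≤-trans (count≤n (mate? τ c′)) (≤-trans fuel (≤-reflexive (+-identityʳ _))))) (n≮n _)
        next (suc k) fuel = go k c′
          (≤-trans fuel (≤-trans (≤-reflexive (+-suc _ k)) (+-monoˡ-≤ k gain))) prot′

    Optimal : Colouring → Set
    Optimal c = Proper c × (∀ c′ → Proper c′ → singles c ≤ singles c′)

    -- Optimal colourings of a critical graph.

    module Critical (critical : ∀ w → DoubleNegation (∃ λ c → Proper c × Single c w)) where

      -- Criticality gives a colouring with `o` single. Taken with fewest singletons and aligned
      -- with `τ`, its only new singleton is `o`, while `e` is lost because distinct singletons are
      -- adjacent. So it is optimal too.
      spread : ∀ {τ e o} → Optimal τ → Single τ e → ¬ Adj e o → o ≢ e →
               DoubleNegation (∃ λ c → Optimal c × Single c o)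
      spread {τ} {e} {o} (pτ , least) se ¬eo o≢e none =
        critical o λ start →
        minimal (λ c → Proper c × Single c o) singles start λ { (c₀ , prot₀) →
        let c , ((pc , so) , _) , within = align τ pτ o c₀ prot₀
            ¬e = λ s → ¬eo (singles-adjacent pc s so (o≢e ∘ sym))
            c≤τ = count-exchange (single? c) (single? τ) o within e ¬e se
        in none (c , (pc , λ d pd → ≤-trans c≤τ (least d pd)) , so) }

      NonAdj : Fin m → Fin m → Set
      NonAdj u v = ¬ Adj u v

      -- Induction on the path. For distinct `u` and `v`, an optimal colouring with `t` single,
      -- aligned with `τ`, gains at most `t`. It loses `u`, not adjacent to `t`, and loses `v` by
      -- the induction hypothesis, which contradicts optimality of `τ`.
      singles-apart : ∀ {u v τ} → Star NonAdj u v → Optimal τ → Single τ u → Single τ v → u ≡ v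
      singles-apart ε _ _ _ = refl
      singles-apart {u} {v} {τ} (_◅_ {j = t} ¬ut path) opt@(pτ , least) su sv with t ≟ u
      ... | yes refl = singles-apart path opt su sv
      ... | no t≢u = decidable-stable (u ≟ v) λ u≢v →
        spread opt su ¬ut t≢u λ { (c₀ , (p₀ , least₀) , s₀) →
        let c , ((pc , st) , leastc) , within = align τ pτ t c₀ ((p₀ , s₀) , λ d (pd , _) → least₀ d pd)
            c≤ : ∀ d → Proper d → singles c ≤ singles d
            c≤ = λ d pd → ≤-trans (leastc c₀ (p₀ , s₀)) (least₀ d pd)
            ¬u = λ s → ¬ut (singles-adjacent pc s st (t≢u ∘ sym))
            ¬v = λ s → case singles-apart path (pc , c≤) st s of λ { refl → ¬ut (singles-adjacent pτ su sv u≢v) }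
            fewer = count-exchange-< (single? c) (single? τ) t within u v u≢v ¬u su ¬v sv
        in <⇒≱ fewer (least c pc) }

      -- Double counting: singletons against the classes of their non-neighbours.

      module Count (¬universal : ∀ v → ∃ λ x → x ≢ v × ¬ Adj v x) {τ} (opt : Optimal τ) where

        private
          pτ : Proper τ
          pτ = proj₁ opt

        Owns : Fin m → Fin q → Set
        Owns v j = Single τ v × ∃ λ w → w ≢ v × τ w ≡ j × ¬ Adj v w

        owns? : ∀ v j → Dec (Owns v j)
        owns? v j = single? τ v ×-dec any? λ w → ¬? (w ≟ v) ×-dec τ w ≟ j ×-dec ¬? (adj? v w)

        -- Two owners are joined by non-edges through their non-neighbours in the class, which is
        -- itself independent.
        owner-unique : ∀ {j} u v → Owns u j → Owns v j → u ≡ v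
        owner-unique u v (su , x , _ , τx≡j , ¬ux) (sv , y , _ , τy≡j , ¬vy) =
          singles-apart (¬ux ◅ pτ (trans τx≡j (sym τy≡j)) ◅ (¬vy ∘ adj-sym) ◅ ε) opt su sv

        -- By optimality the class of `x` is a pair of `x` and a neighbour `z` of `v`. In an optimal
        -- colouring with `x` single, `v` has a class mate `w`. It is not adjacent to `v`, and it is
        -- neither `x` nor `z`, so it lies in another class of `τ`.
        second-class : ∀ {v x} → Single τ v → x ≢ v → ¬ Adj v x →
                       DoubleNegation (∃ λ w → w ≢ v × ¬ Adj v w × τ w ≢ τ x)
        second-class {v} {x} sv x≢v ¬vx none with move pτ sv x≢v ¬vx
        ... | pτ′ , _ , z , _ , _ , vz , exact =
          spread opt sv ¬vx x≢v λ { (c , (pc , _) , sx) → lonely c pc sx (singleOrMate c v) }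
          where
          lonely : ∀ c → Proper c → Single c x → Single c v ⊎ (∃ λ w → w ≢ v × c w ≡ c v) → ⊥
          lonely c pc sx (inj₁ s) = ¬vx (singles-adjacent pc s sx (x≢v ∘ sym))
          lonely c pc sx (inj₂ (w , w≢v , cw≡cv)) =
            none (w , w≢v , pc (sym cw≡cv) , λ τw≡τx → case exact (proj₂ opt _ pτ′) w τw≡τx of λ
              { (inj₁ refl) → x≢v (sym (sx v (sym cw≡cv)))
              ; (inj₂ refl) → pc (sym cw≡cv) vz })

        owns-two : ∀ v → 2 * indicator (single? τ v) ≤ count (owns? v)
        owns-two v = bound (single? τ v)
          where
          bound : (s? : Dec (Single τ v)) → 2 * indicator s? ≤ count (owns? v)
          bound (no _) = z≤n
          bound (yes sv) = decidable-stable (2 ≤? count (owns? v)) λ ¬two →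
            let x , x≢v , ¬vx = ¬universal v in
            second-class sv x≢v ¬vx λ (w , w≢v , ¬vw , τw≢τx) →
            ¬two (count-two (owns? v) (τ x) (τ w) (τw≢τx ∘ sym)
              (sv , x , x≢v , refl , ¬vx) (sv , w , w≢v , refl , ¬vw))

        inClass? : ∀ j v → Dec (τ v ≡ j)
        inClass? j v = τ v ≟ j

        singleIn? : ∀ j v → Dec (Single τ v × τ v ≡ j)
        singleIn? j v = single? τ v ×-dec τ v ≟ j

        -- A singleton class has no owner, as singletons are adjacent: 5 + 0 = 3 + 2. A larger class
        -- has at most one: 5 + 1 = 3 * 2.
        class-bound : ∀ j → 5 + count (λ v → owns? v j) ≤
                            3 * count (inClass? j) + 2 * count (singleIn? j)
        class-bound j with onto τ pτ j
        ... | r , τr≡j with singleOrMate τ r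
        ...   | inj₁ sr = ≤-trans
          (≤-reflexive (cong (5 +_) (count-none (λ v → owns? v j) λ { v (sv , w , w≢v , τw≡j , ¬vw) →
            ¬vw (singles-adjacent pτ sv
              (subst (Single τ) (sym (sr w (trans τw≡j (sym τr≡j)))) sr) (w≢v ∘ sym)) })))
          (+-mono-≤ (*-monoʳ-≤ 3 (count-one (inClass? j) r τr≡j))
                    (*-monoʳ-≤ 2 (count-one (singleIn? j) r (sr , τr≡j))))
        ...   | inj₂ (r′ , r′≢r , e) = ≤-trans
          (+-monoʳ-≤ 5 (count-unique (λ v → owns? v j) owner-unique))
          (≤-trans (*-monoʳ-≤ 3 (count-two (inClass? j) r′ r r′≢r (trans e τr≡j) τr≡j)) (m≤m+n _ _))

        -- Sum `class-bound` over all classes. Each singleton owns at least two classes, so the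
        -- owners on the left outweigh the term 2 * `singles τ` on the right.
        5q≤3m : 5 * q ≤ 3 * m
        5q≤3m = +-cancelʳ-≤ (2 * singles τ) (5 * q) (3 * m) (begin
          5 * q + 2 * singles τ
            ≤⟨ +-monoʳ-≤ (5 * q) (≤-trans (≤-reflexive (*-distribˡ-sum 2 (indicator ∘ single? τ))) (sum-mono-≤ owns-two)) ⟩
          5 * q + sum (λ v → count (owns? v))
            ≡⟨ cong₂ _+_ (trans (*-comm 5 q) (sym (sum-const q 5))) (∑-comm (λ v j → indicator (owns? v j))) ⟩
          sum {q} (const 5) + sum (λ j → count (λ v → owns? v j))
            ≡⟨ ∑-distrib-+ (const 5) (λ j → count (λ v → owns? v j)) ⟨
          sum (λ j → 5 + count (λ v → owns? v j))
            ≤⟨ sum-mono-≤ class-bound ⟩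
          sum (λ j → 3 * count (inClass? j) + 2 * count (singleIn? j))
            ≡⟨ ∑-distrib-+ (λ j → 3 * count (inClass? j)) (λ j → 2 * count (singleIn? j)) ⟩
          sum (λ j → 3 * count (inClass? j)) + sum (λ j → 2 * count (singleIn? j))
            ≡⟨ cong₂ _+_ (*-distribˡ-sum 3 (λ j → count (inClass? j))) (*-distribˡ-sum 2 (λ j → count (singleIn? j))) ⟨
          3 * sum (λ j → count (inClass? j)) + 2 * sum (λ j → count (singleIn? j))
            ≡⟨ cong₂ (λ a b → 3 * a + 2 * b) (∑-comm (λ j v → indicator (inClass? j v))) (∑-comm (λ j v → indicator (singleIn? j v))) ⟩
          3 * sum (λ v → count (λ j → inClass? j v)) + 2 * sum (λ v → count (λ j → singleIn? j v))
            ≤⟨ +-mono-≤ (*-monoʳ-≤ 3 (≤-trans (sum-mono-≤ {g = const 1} one-class) (≤-reflexive (trans (sum-const m 1) (*-identityʳ m)))))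
                        (*-monoʳ-≤ 2 (sum-mono-≤ one-single)) ⟩
          3 * m + 2 * singles τ ∎)
          where
          open ≤-Reasoning
          one-class : ∀ v → count (λ j → inClass? j v) ≤ 1
          one-class v = count-unique (λ j → inClass? j v) λ i j e f → trans (sym e) f
          one-single : ∀ v → count (λ j → singleIn? j v) ≤ indicator (single? τ v)
          one-single v = bound (single? τ v)
            where
            bound : (s? : Dec (Single τ v)) → count (λ j → singleIn? j v) ≤ indicator s?
            bound (no ¬s) = ≤-reflexive (count-none (λ j → singleIn? j v) λ j (s , _) → ¬s s)
            bound (yes s) = count-unique (λ j → singleIn? j v) λ i j (_ , e) (_ , f) → trans (sym e) f

-- Reduction to critical graphs by deleting vertices.

Colours : {m : ℕ} → (Fin m → Fin m → Set) → ℕ → Set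
Colours {m} Adj k = ∃ λ (c : Fin m → Fin k) → ∀ {u v} → c u ≡ c v → ¬ Adj u v

ColoursNbhd : {m : ℕ} → (Fin m → Fin m → Set) → Fin m → ℕ → Set
ColoursNbhd {m} Adj v k = ∃ λ (c : Fin m → Fin k) →
  ∀ {u w} → u ≡ v ⊎ Adj v u → w ≡ v ⊎ Adj v w → c u ≡ c w → ¬ Adj u w

-- A consequence of Gallai's theorem on colour-critical graphs: a critical
-- (k+1)-chromatic graph on m < 5(k+1)/3 vertices has a universal vertex.
few-vertices⇒full-nbhd : ∀ m k (Adj : Fin m → Fin m → Set) → (∀ u v → Dec (Adj u v)) →
  (∀ {u v} → Adj u v → Adj v u) → ¬ Colours Adj k → 3 * m < 5 * suc k →
  ¬ (∀ v → ColoursNbhd Adj v k)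
few-vertices⇒full-nbhd zero k Adj _ _ ¬col _ _ = ¬col ((λ ()) , λ { {()} })
-- The goal is a negation, so the case split may be classical. Deleting a vertex that leaves the
-- graph not `k`-colourable keeps all hypotheses; if there is none, the graph is critical.
few-vertices⇒full-nbhd (suc m) k Adj adj? adj-sym ¬col few nbhds = ¬¬-excluded-middle {A = ∃ Deletable} λ
  { (yes (w , ¬col-w)) →
      few-vertices⇒full-nbhd m k (λ u v → Adj (punchIn w u) (punchIn w v))
        (λ u v → adj? (punchIn w u) (punchIn w v)) adj-sym ¬col-w
        (≤-<-trans (*-monoʳ-≤ 3 (n≤1+n m)) few)
        (λ v → let c , pc = nbhds (punchIn w v) in
          c ∘ punchIn w , λ u∈ x∈ → pc (Sum.map₁ (cong (punchIn w)) u∈) (Sum.map₁ (cong (punchIn w)) x∈))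
  ; (no ¬deletable) →
      critical ¬deletable zero λ (c , pc , _) →
      minimal Proper singles (c , pc) λ (τ , opt) →
      <⇒≱ few (Critical.Count.5q≤3m (critical ¬deletable) ¬universal opt) }
  where
  open Colourings {suc m} {suc k} Adj adj? adj-sym
  onto : ∀ c → Proper c → ∀ i → ∃ λ v → c v ≡ i
  onto c pc i = decidable-stable (any? (λ v → c v ≟ i)) λ unused →
    ¬col ((λ v → punchOut (missed unused v)) , λ {u} {v} e →
          pc (punchOut-injective (missed unused u) (missed unused v) e))
    where
    missed : ¬ (∃ λ v → c v ≡ i) → ∀ v → i ≢ c v
    missed unused v i≡cv = unused (v , sym i≡cv)
  open Onto onto
  Deletable : Fin (suc m) → Set
  Deletable w = ¬ Colours (λ u v → Adj (punchIn w u) (punchIn w v)) k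
  -- A `k`-colouring of the rest is shifted up by one, and colour zero is kept for `w` alone.
  critical : ¬ ∃ Deletable → ∀ w → DoubleNegation (∃ λ c → Proper c × Single c w)
  critical ¬deletable w none = ¬deletable (w , λ (c , pc) → none (extend c , extend-proper c pc , extend-single c))
    where
    extend : (Fin m → Fin k) → Colouring
    extend c v with w ≟ v
    ... | yes _ = zero
    ... | no w≢v = suc (c (punchOut w≢v))
    extend-proper : ∀ c → (∀ {u v} → c u ≡ c v → ¬ Adj (punchIn w u) (punchIn w v)) → Proper (extend c)
    extend-proper c pc {u} {v} e with w ≟ u | w ≟ v
    -- The colouring of the closed neighbourhood excludes a loop at `w`.
    ... | yes refl | yes refl = proj₂ (nbhds w) (inj₁ refl) (inj₁ refl) refl
    ... | no w≢u | no w≢v = subst₂ (λ x y → ¬ Adj x y) (punchIn-punchOut w≢u) (punchIn-punchOut w≢v)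
                              (pc (suc-injective e))
    extend-single : ∀ c → Single (extend c) w
    extend-single c u e with w ≟ u | w ≟ w
    ... | yes w≡u | _ = sym w≡u
    ... | no _ | no w≢w = contradiction refl w≢w
  ¬universal : ∀ v → ∃ λ x → x ≢ v × ¬ Adj v x
  -- The closed neighbourhood of a universal vertex is the whole graph, which would then be
  -- `k`-colourable.
  ¬universal v = decidable-stable (any? λ x → ¬? (x ≟ v) ×-dec ¬? (adj? v x)) λ universal →
    let c , pc = nbhds v
        near = λ x → decidable-stable (x ≟ v ⊎-dec adj? v x) λ far → universal (x , far ∘ inj₁ , far ∘ inj₂)
    in ¬col (c , λ {u} {w} → pc (near u) (near w))

-- Finite search and duplicate-free lists.

function-search : ∀ n {k} (P : (Fin n → Fin k) → Set) → (∀ {f g} → f ≗ g → P f → P g) →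
                  (∀ f → Dec (P f)) → Dec (∃ P)
-- A function agrees only pointwise with the copy rebuilt from its values, hence the assumption that
-- `P` respects `≗`.
function-search zero P resp P? = map′ (_ ,_) (λ (f , pf) → resp (λ ()) pf) (P? λ ())
function-search (suc n) P resp P? = map′
  (λ (i , f , p) → i ∷ᶠ f , p)
  (λ (f , p) → f zero , f ∘ suc , resp (λ { zero → refl ; (suc _) → refl }) p)
  (any? λ i → function-search n (λ f → P (i ∷ᶠ f))
    (λ f≗g → resp λ { zero → refl ; (suc j) → f≗g j }) (λ f → P? (i ∷ᶠ f)))

does⇒ : {A : Set} (a? : Dec A) → does a? ≡ true → A
does⇒ (yes a) _ = a

lookup-injective : ∀ {A : Set} {xs : List A} → Unique xs → ∀ {i j} → lookup xs i ≡ lookup xs j → i ≡ j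
lookup-injective (x∉ ∷ _) {zero}  {zero}  _ = refl
lookup-injective {xs = _ ∷ xs} (x∉ ∷ _) {zero}  {suc j} e = contradiction e (All-lookup x∉ (∈-lookup {xs = xs} j))
lookup-injective {xs = _ ∷ xs} (x∉ ∷ _) {suc i} {zero}  e = contradiction (sym e) (All-lookup x∉ (∈-lookup {xs = xs} i))
lookup-injective (_ ∷ uniq) {suc i} {suc j} e = cong suc (lookup-injective uniq e)

another : 2 ≤ n → (v : Fin n) → ∃ λ u → u ≢ v
another (s≤s (s≤s _)) v = punchIn v zero , punchInᵢ≢i v zero

-- Chromatic numbers of induced subgraphs.

module InGraph (G : Graph) where

  private
    V : Set
    V = Fin (order G)

  adj?ᴳ : ∀ (u v : V) → Dec (adj G u v ≡ true)
  adj?ᴳ u v = adj G u v ≟ᵇ true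

  colourable? : ∀ S k → Dec (Colourable G S k)
  colourable? S k = function-search (order G) _
    (λ f≗g pf u v su sv a e → pf u v su sv a (trans (f≗g u) (trans e (sym (f≗g v)))))
    (λ c → all? λ u → all? λ v → (S u ≟ᵇ true) →-dec (S v ≟ᵇ true) →-dec adj?ᴳ u v →-dec ¬? (c u ≟ c v))

  colourable-mono : ∀ {S j k} → j ≤ k → Colourable G S j → Colourable G S k
  colourable-mono j≤k (c , pc) = (λ v → inject≤ (c v) j≤k) ,
    λ u v su sv a e → pc u v su sv a (inject≤-injective j≤k j≤k _ _ e)

  chromatic : ∀ {S} k → Colourable G S k → ∃ λ h → h ≤ k × IsChromaticNumber G S h
  chromatic zero col = 0 , z≤n , col , λ _ _ → z≤n
  chromatic {S} (suc k) col with colourable? S k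
  ... | yes col′ = let h , h≤k , isχ = chromatic k col′ in h , m≤n⇒m≤1+n h≤k , isχ
  ... | no ¬col = suc k , ≤-refl , col , λ j colj → ≰⇒> λ j≤k → ¬col (colourable-mono j≤k colj)

  -- Any second vertex `u` gives a `t`-colouring of the open neighbourhood; `v` receives a new
  -- colour.
  closed-nbhd : ∀ {t} → CoLocallyColourable G t → 2 ≤ order G → ∀ v →
                ColoursNbhd (λ x y → adj G x y ≡ true) v (suc t)
  closed-nbhd {t} colocal 2≤n v with another 2≤n v
  ... | u , u≢v with colocal v u u≢v
  ...   | c , pc = c⁺ , proper
    where
    c⁺ : V → Fin (suc t)
    c⁺ w with w ≟ v
    ... | yes _ = zero
    ... | no _ = suc (c w)
    member : ∀ {w} → w ≢ v → w ≡ v ⊎ adj G v w ≡ true → uPlusNbhd G u v w ≡ true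
    member w≢v (inj₁ w≡v) = contradiction w≡v w≢v
    member {w} _ (inj₂ a) = trans (cong (does (w ≟ u) ∨_) a) (∨-zeroʳ _)
    proper : ∀ {x y} → x ≡ v ⊎ adj G v x ≡ true → y ≡ v ⊎ adj G v y ≡ true → c⁺ x ≡ c⁺ y → adj G x y ≢ true
    proper {x} {y} x∈ y∈ e a with x ≟ v | y ≟ v
    ... | yes refl | yes refl = case trans (sym a) (irrefl G x) of λ ()
    ... | no x≢v | no y≢v = pc x y (member x≢v x∈) (member y≢v y∈) a (suc-injective e)

  -- Colours shown by vertex sets.

  module WithColouring (σ : V → ℕ) (σ-proper : ∀ u v → adj G u v ≡ true → σ u ≢ σ v) where

    palette : VSet G → List ℕ
    palette S = deduplicate _≟ℕ_ (map σ (filterᵇ S (allFin (order G))))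

    ∈-palette : ∀ {S v} → S v ≡ true → σ v ∈ palette S
    ∈-palette {S} {v} sv = ∈-deduplicate⁺ _≟ℕ_
      (∈-map⁺ σ (∈-filter⁺ (T? ∘ S) (∈-allFin v) (Equivalence.from T-≡ sv)))

    palette-∈ : ∀ {S k} → k ∈ palette S → ∃ λ v → σ v ≡ k
    palette-∈ {S} k∈ = let v , _ , e = ∈-map⁻ σ (∈-deduplicate⁻ _≟ℕ_ _ k∈) in v , sym e

    rainbow≤coloursUsed : ∀ {a S} (r : Fin a → V) → (∀ i → S (r i) ≡ true) →
                          (∀ {i j} → σ (r i) ≡ σ (r j) → i ≡ j) → a ≤ coloursUsed G σ S
    rainbow≤coloursUsed r r∈S inj = injective⇒≤ {f = λ i → index (∈-palette (r∈S i))} λ {i} {j} e →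
      inj (index-injective (setoid ℕ) (∈-palette (r∈S i)) (∈-palette (r∈S j)) e)

    -- Any `k`-colouring serves, because passing to the chromatic number only weakens what must be
    -- shown.
    phi-bound : ∀ {S k m s} → NonEmpty G S → Colourable G S k → k + m ≤ coloursUsed G σ S + s →
                PhiSigmaAtLeast G (σ , σ-proper) m s
    phi-bound {S} {k} {m} ne col le = let h , h≤k , isχ = chromatic k col in
      S , h , ne , isχ , ≤-trans (+-monoˡ-≤ m h≤k) le

    -- The colour classes of `σ`, numbered without gaps and with a representative of each.
    record Palette : Set where
      field
        size      : ℕ
        colour    : V → Fin size
        rep       : Fin size → V
        colour-rep : ∀ i → colour (rep i) ≡ i
        colour⇒σ  : ∀ {u v} → colour u ≡ colour v → σ u ≡ σ v
        σ⇒colour  : ∀ {u v} → σ u ≡ σ v → colour u ≡ colour v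

    allColours : Palette
    allColours = record
      { size = length L
      ; colour = colour
      ; rep = rep
      ; colour-rep = λ i → lookup-unique (trans (sym (lookup-colour (rep i))) (σ-rep i))
      ; colour⇒σ = λ {u} {v} e → trans (lookup-colour u) (trans (cong (lookup L) e) (sym (lookup-colour v)))
      ; σ⇒colour = λ {u} {v} e → lookup-unique (trans (sym (lookup-colour u)) (trans e (lookup-colour v)))
      }
      where
      L = palette (allV G)
      mem : ∀ v → σ v ∈ L
      mem v = ∈-palette {allV G} {v} refl
      colour : V → Fin (length L)
      colour v = index (mem v)
      rep : Fin (length L) → V
      rep i = proj₁ (palette-∈ {allV G} (∈-lookup i))
      σ-rep : ∀ i → σ (rep i) ≡ lookup L i
      σ-rep i = proj₂ (palette-∈ {allV G} (∈-lookup i))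
      lookup-colour : ∀ v → σ v ≡ lookup L (colour v)
      lookup-colour v = lookup-index (mem v)
      lookup-unique : ∀ {i j} → lookup L i ≡ lookup L j → i ≡ j
      lookup-unique = lookup-injective (deduplicate-! _≟ℕ_ (map σ (filterᵇ (allV G) (allFin (order G)))))

    -- If every vertex of some class missed another colour, the class could be
    -- recoloured away.
    sees-all-in-class : ∀ {k} (c : V → Fin k) → (∀ u v → adj G u v ≡ true → c u ≢ c v) →
      (∀ j → Colourable G (allV G) j → k ≤ j) → ∀ w →
      ∃ λ v → c v ≡ c w × (∀ i → i ≡ c v ⊎ ∃ λ x → adj G v x ≡ true × c x ≡ i)
    sees-all-in-class {zero} c _ _ w = case c w of λ ()
    sees-all-in-class {suc k} c pc least w =
      decidable-stable (any? λ v → c v ≟ c w ×-dec all? (sees? v)) λ none →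
      n≮n k (least k (recoloured none))
      where
      Sees : V → Fin (suc k) → Set
      Sees v i = i ≡ c v ⊎ ∃ λ x → adj G v x ≡ true × c x ≡ i
      sees? : ∀ v i → Dec (Sees v i)
      sees? v i = i ≟ c v ⊎-dec any? λ x → adj?ᴳ v x ×-dec c x ≟ i
      -- Vertices of the class take a colour they do not see, the others keep theirs. All avoid
      -- `c w`, which is then punched out.
      New : V → Set
      New v = ∃ λ j → c w ≢ j × (c v ≡ c w × ¬ Sees v j ⊎ c v ≢ c w × j ≡ c v)
      recoloured : ¬ ∃ (λ v → c v ≡ c w × ∀ i → Sees v i) → Colourable G (allV G) k
      recoloured none = (λ v → punchOut (proj₁ (proj₂ (new v)))) , λ u v _ _ a e →
          distinct u v a (new u) (new v) (punchOut-injective (proj₁ (proj₂ (new u))) (proj₁ (proj₂ (new v))) e)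
        where
        new : ∀ v → New v
        new v with c v ≟ c w
        ... | no v∉ = c v , v∉ ∘ sym , inj₂ (v∉ , refl)
        ... | yes v∈ = let j , ¬sees = ¬∀⟶∃¬ (suc k) (Sees v) (sees? v) (λ all → none (v , v∈ , all)) in
          j , (λ e → ¬sees (inj₁ (trans (sym e) (sym v∈)))) , inj₁ (v∈ , ¬sees)
        distinct : ∀ u v → adj G u v ≡ true → (nu : New u) (nv : New v) → proj₁ nu ≢ proj₁ nv
        distinct u v a (_ , _ , inj₁ (u∈ , _)) (_ , _ , inj₁ (v∈ , _)) _ = pc u v a (trans u∈ (sym v∈))
        distinct u v a (_ , _ , inj₁ (_ , ¬sees)) (_ , _ , inj₂ (_ , refl)) refl = ¬sees (inj₂ (v , a , refl))
        distinct u v a (_ , _ , inj₂ (_ , refl)) (_ , _ , inj₁ (_ , ¬sees)) refl =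
          ¬sees (inj₂ (u , trans (adj-symmetric G v u) a , refl))
        distinct u v a (_ , _ , inj₂ (_ , refl)) (_ , _ , inj₂ (_ , refl)) e = pc u v a e

    -- Neighbourhoods showing all colours, and complete graphs.

    module WithPalette (pal : Palette) where

      open Palette pal

      colour-proper : ∀ u v → adj G u v ≡ true → colour u ≢ colour v
      colour-proper u v a e = σ-proper u v a (colour⇒σ e)

      rep-injective : ∀ {i j} → rep i ≡ rep j → i ≡ j
      rep-injective {i} {j} e = trans (sym (colour-rep i)) (trans (cong colour e) (colour-rep j))

      -- The neighbours of `v` show every colour but its own, which the twin `u` supplies.
      twin-bound : ∀ {u v} → u ≢ v → colour u ≡ colour v →
        (∀ i → i ≡ colour v ⊎ ∃ λ x → adj G v x ≡ true × colour x ≡ i) →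
        size ≤ coloursUsed G σ (uPlusNbhd G u v)
      twin-bound {u} {v} u≢v cu≡cv sees = rainbow≤coloursUsed r r∈ λ {i} {j} e →
          trans (sym (colour-r i)) (trans (σ⇒colour e) (colour-r j))
        where
        pick : ∀ i → ∃ λ x → uPlusNbhd G u v x ≡ true × colour x ≡ i
        pick i with sees i
        ... | inj₁ refl = u , cong (_∨ adj G v u) (dec-true (u ≟ u) refl) , cu≡cv
        ... | inj₂ (x , a , e) = x , trans (cong (does (x ≟ u) ∨_) a) (∨-zeroʳ _) , e
        r : Fin size → V
        r i = proj₁ (pick i)
        r∈ : ∀ i → uPlusNbhd G u v (r i) ≡ true
        r∈ i = proj₁ (proj₂ (pick i))
        colour-r : ∀ i → colour (r i) ≡ i
        colour-r i = proj₂ (proj₂ (pick i))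

      -- The vertex that sees all colours in the class of `v` must be `v`, or `v` would be its twin.
      -- So every vertex sees all colours and has no twin.
      all-classes-trivial⇒complete : (∀ v → ∀ u → u ≢ v → size ≰ coloursUsed G σ (uPlusNbhd G u v)) →
        (∀ j → Colourable G (allV G) j → size ≤ j) →
        (∀ {u v} → colour u ≡ colour v → u ≡ v) × (∀ u v → u ≢ v → adj G u v ≡ true)
      all-classes-trivial⇒complete small least = inj , complete
        where
        sees-all : ∀ v i → i ≡ colour v ⊎ ∃ λ x → adj G v x ≡ true × colour x ≡ i
        sees-all v i with sees-all-in-class colour colour-proper least v
        ... | w , e , sees with v ≟ w
        ...   | yes refl = sees i
        ...   | no v≢w = contradiction (twin-bound v≢w (sym e) sees) (small w v v≢w)
        inj : ∀ {u v} → colour u ≡ colour v → u ≡ v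
        inj {u} {v} e = decidable-stable (u ≟ v) λ u≢v → small v u u≢v (twin-bound u≢v e (sees-all v))
        complete : ∀ u v → u ≢ v → adj G u v ≡ true
        complete u v u≢v with sees-all u (colour v)
        ... | inj₁ e = contradiction (inj (sym e)) u≢v
        ... | inj₂ (x , a , e) = subst (λ y → adj G u y ≡ true) (inj e) a

      -- Here `suc s` is the parameter of the theorem. In a complete graph the closed neighbourhood
      -- is everything, so χ is at most `suc s`, and G is the excluded complete graph.
      complete-case : ∀ {s χ} → CoLocallyColourable G s → ¬ IsComplete G (suc s) → 1 ≤ s →
        suc s ≤ χ → (∀ j → Colourable G (allV G) j → χ ≤ j) → χ ≡ size →
        ¬ (∀ v u → u ≢ v → size ≰ coloursUsed G σ (uPlusNbhd G u v))
      complete-case {s} colocal ¬complete 1≤s s<χ least refl small =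
        ¬complete (order≡ , complete)
        where
        trivial-classes = all-classes-trivial⇒complete small least
        complete = proj₂ trivial-classes
        n≡χ : order G ≡ size
        n≡χ = ≤-antisym (injective⇒≤ (proj₁ trivial-classes)) (injective⇒≤ rep-injective)
        2≤n : 2 ≤ order G
        2≤n = ≤-trans (s≤s 1≤s) (≤-trans s<χ (≤-reflexive (sym n≡χ)))
        v₀ : V
        v₀ = fromℕ< (nonempty G)
        near : ∀ u → u ≡ v₀ ⊎ adj G v₀ u ≡ true
        near u with u ≟ v₀
        ... | yes e = inj₁ e
        ... | no u≢v = inj₂ (complete v₀ u (u≢v ∘ sym))
        χ≤1+s : size ≤ suc s
        χ≤1+s = let c , pc = closed-nbhd colocal 2≤n v₀ in
          least (suc s) (c , λ u v _ _ a e → pc (near u) (near v) e a)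
        order≡ : order G ≡ suc s
        order≡ = trans n≡χ (≤-antisym χ≤1+s s<χ)

      -- A transversal of the colour classes.

      transversal : VSet G
      transversal v = does (any? λ i → rep i ≟ v)

      rep∈transversal : ∀ i → transversal (rep i) ≡ true
      rep∈transversal i = dec-true (any? λ j → rep j ≟ rep i) (i , refl)

      transversal-size : size ≤ coloursUsed G σ transversal
      transversal-size = rainbow≤coloursUsed rep rep∈transversal λ {i} {j} e →
        trans (sym (colour-rep i)) (trans (σ⇒colour e) (colour-rep j))

      -- The class indices serve as the vertices of the subgraph induced on the transversal. It is
      -- not `k`-colourable, but its closed neighbourhoods are, as `suc s` colours suffice for them.
      transversal-few : ∀ {s k} → CoLocallyColourable G s → 2 ≤ order G → suc s ≤ k →
        IsChromaticNumber G transversal (suc k) → 5 * suc k ≤ 3 * size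
      transversal-few {s} {k} colocal 2≤n s<k (_ , least) = ≮⇒≥ λ few →
        few-vertices⇒full-nbhd size k (λ i j → adj G (rep i) (rep j) ≡ true)
          (λ i j → adj?ᴳ (rep i) (rep j)) (λ a → trans (adj-symmetric G _ _) a)
          (λ (c , pc) → n≮n k (least k (c ∘ colour , pull c pc))) few
          (λ v → let c , pc = closed-nbhd colocal 2≤n (rep v) in
            (λ i → inject≤ (c (rep i)) s<k) , λ x∈ y∈ e →
              pc (Sum.map₁ (cong rep) x∈) (Sum.map₁ (cong rep) y∈) (inject≤-injective s<k s<k _ _ e))
        where
        pull : ∀ (c : Fin size → Fin k) → (∀ {i j} → c i ≡ c j → adj G (rep i) (rep j) ≢ true) →
          ∀ u v → transversal u ≡ true → transversal v ≡ true → adj G u v ≡ true → c (colour u) ≢ c (colour v)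
        pull c pc u v u∈ v∈ a e with does⇒ (any? λ i → rep i ≟ u) u∈ | does⇒ (any? λ i → rep i ≟ v) v∈
        ... | i , refl | j , refl =
          pc (trans (cong c (sym (colour-rep i))) (trans e (cong c (colour-rep j)))) a

-- The first hypothesis is the failure of the bound for a transversal of `m` classes with chromatic
-- number `h`.
transversal-arithmetic : ∀ {s χ m h} → m + s < h + (χ + 1) → χ < m → 3 * χ < 5 * s + 2 → s < h × 3 * m < 5 * h
transversal-arithmetic {s} {χ} {m} {h} m+s< χ<m 3χ< = s<h , +-cancelʳ-< (3 * s) _ _ (begin-strict
    3 * m + 3 * s       ≡⟨ *-distribˡ-+ 3 m s ⟨
    3 * (m + s)         ≤⟨ *-monoʳ-≤ 3 m+s≤ ⟩
    3 * (h + χ)         ≡⟨ *-distribˡ-+ 3 h χ ⟩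
    3 * h + 3 * χ       <⟨ +-monoʳ-< (3 * h) 3χ< ⟩
    -- The constant 2 turns 5 * s + 2 into 2 * (s + 1) + 3 * s, where s + 1 is at most `h`.
    3 * h + (5 * s + 2) ≡⟨ regroup h s ⟩
    3 * h + 2 * suc s + 3 * s ≤⟨ +-monoˡ-≤ (3 * s) (+-monoʳ-≤ (3 * h) (*-monoʳ-≤ 2 s<h)) ⟩
    3 * h + 2 * h + 3 * s ≡⟨ cong (_+ 3 * s) (*-distribʳ-+ h 3 2) ⟨
    5 * h + 3 * s       ∎)
  where
  open ≤-Reasoning
  regroup : ∀ h s → 3 * h + (5 * s + 2) ≡ 3 * h + 2 * suc s + 3 * s
  regroup = solve-∀
  m+s≤ : m + s ≤ h + χ
  m+s≤ = ≤-pred (≤-trans m+s< (≤-reflexive (trans (cong (h +_) (+-comm χ 1)) (+-suc h χ))))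
  s<h : s < h
  s<h = +-cancelʳ-≤ χ (suc s) h (begin
    suc s + χ ≡⟨ +-comm (suc s) χ ⟩
    χ + suc s ≡⟨ +-suc χ s ⟩
    suc χ + s ≤⟨ +-monoˡ-≤ s χ<m ⟩
    m + s     ≤⟨ m+s≤ ⟩
    h + χ     ∎)

-- The theorem, by comparing χ with s and with the number of colours used.

theorem4p6 : ∀ (s : ℕ) → 3 ≤ s → (G : Graph) → CoLocallyColourable G (s ∸ 1)
    → ¬ IsComplete G s → (χ : ℕ) → ChromaticNumber G χ → 3 * χ < 5 * s + 2
    → (σ : ProperColouring G) → PhiSigmaAtLeast G σ (χ + 1) s
-- From here on `suc s` is the parameter of the statement, and `colocal` gives `s`-colourings.
theorem4p6 (suc s) (s≤s 2≤s) G colocal ¬complete χ (χ-col , least) 3χ< (σ , σ-proper) = split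
  where
  open InGraph G
  open WithColouring σ σ-proper
  open Palette allColours
  open WithPalette allColours
  v₀ : Fin (order G)
  v₀ = fromℕ< (nonempty G)
  χ≤size : χ ≤ size
  χ≤size = least size (colour , λ u v _ _ → colour-proper u v)

  -- One vertex gives the difference 1 - 1 = 0, which is enough since χ + 1 is at most `suc s`.
  below : χ ≤ s → PhiSigmaAtLeast G (σ , σ-proper) (χ + 1) (suc s)
  below χ≤s = phi-bound {S = λ v → does (v ≟ v₀)} {k = 1} (v₀ , v₀∈)
    ((λ _ → zero) , λ u v u∈ v∈ a _ → case trans (sym a) (loop u v u∈ v∈) of λ ())
    (+-mono-≤ (rainbow≤coloursUsed {a = 1} (λ _ → v₀) (λ _ → v₀∈) λ { {zero} {zero} _ → refl })
              (≤-trans (≤-reflexive (+-comm χ 1)) (s≤s χ≤s)))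
    where
    v₀∈ : does (v₀ ≟ v₀) ≡ true
    v₀∈ = dec-true (v₀ ≟ v₀) refl
    loop : ∀ u v → does (u ≟ v₀) ≡ true → does (v ≟ v₀) ≡ true → adj G u v ≡ false
    loop u v u∈ v∈ with does⇒ (u ≟ v₀) u∈ | does⇒ (v ≟ v₀) v∈
    ... | refl | refl = irrefl G v₀

  optimal-colouring : suc s ≤ χ → χ ≡ size → PhiSigmaAtLeast G (σ , σ-proper) (χ + 1) (suc s)
  optimal-colouring s<χ χ≡size
    with any? (λ v → any? λ u → ¬? (u ≟ v) ×-dec size ≤? coloursUsed G σ (uPlusNbhd G u v))
  -- All χ colours on an `s`-colourable set meet the bound exactly.
  ... | yes (v , u , u≢v , size≤) = phi-bound
    (u , cong (_∨ adj G v u) (dec-true (u ≟ u) refl)) (colocal v u u≢v) (begin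
      s + (χ + 1)   ≡⟨ +-comm s (χ + 1) ⟩
      χ + 1 + s     ≡⟨ +-assoc χ 1 s ⟩
      χ + suc s     ≤⟨ +-monoˡ-≤ (suc s) (≤-trans χ≤size size≤) ⟩
      coloursUsed G σ (uPlusNbhd G u v) + suc s ∎)
    where open ≤-Reasoning
  ... | no none = ⊥-elim (complete-case colocal ¬complete (≤-trans (s≤s z≤n) 2≤s)
    s<χ least χ≡size λ v u u≢v le → none (v , u , u≢v , le))

  wasteful-colouring : suc s ≤ χ → χ < size → PhiSigmaAtLeast G (σ , σ-proper) (χ + 1) (suc s)
  wasteful-colouring s<χ χ<size with chromatic {transversal} size
    (colour , λ u v _ _ → colour-proper u v)
  ... | h , _ , isχ with h + (χ + 1) ≤? size + suc s
  ...   | yes le = phi-bound (rep (colour v₀) , rep∈transversal _) (proj₁ isχ)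
    (≤-trans le (+-monoˡ-≤ (suc s) (transversal-size)))
  ...   | no ¬le = contradiction isχ (large h (≰⇒> ¬le))
    where
    2≤n : 2 ≤ order G
    2≤n = ≤-trans (m≤n⇒m≤1+n 2≤s) (≤-trans s<χ (≤-trans χ≤size
      (injective⇒≤ (rep-injective))))
    large : ∀ h → size + suc s < h + (χ + 1) → ¬ IsChromaticNumber G (transversal) h
    -- `h` is generalised so that it can be split; zero is excluded because `h` exceeds `suc s`.
    large zero lt _ = case proj₁ (transversal-arithmetic {h = zero} lt χ<size 3χ<) of λ ()
    large (suc k) lt isχ = let s<h , few = transversal-arithmetic {h = suc k} lt χ<size 3χ< in
      <⇒≱ few (transversal-few colocal 2≤n (≤-pred s<h) isχ)

  split : PhiSigmaAtLeast G (σ , σ-proper) (χ + 1) (suc s)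
  split with χ ≤? s | χ <? size
  ... | yes χ≤s | _ = below χ≤s
  ... | no χ≰s | yes χ<size = wasteful-colouring (≰⇒> χ≰s) χ<size
  ... | no χ≰s | no χ≮size = optimal-colouring (≰⇒> χ≰s) (≤-antisym χ≤size (≮⇒≥ χ≮size))
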